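{- Let $G$ be a finite group of order $n$ and $\ell$ an integer. If the exponent of $G$ does not divide $\ell$, then $$\frac{|\{g\in G:g^\ell=1\}|}{n}\le 1-\frac1{\sqrt{2n}}.$$ -}

module Defs where

open import Level using (Level; 0ℓ; _⊔_) renaming (suc to lsuc)
open import Algebra.Bundles using (Group)
import Algebra.Properties.Group as GroupProperties
open import Data.Empty using (⊥-elim)
open import Data.Fin using (Fin; toℕ)
import Data.Fin.Properties as Fin
open import Data.Integer using (ℤ; +_; -[1+_])
open import Data.Nat as ℕ using (ℕ; zero; suc; NonZero; _!)
import Data.Nat.Properties as ℕ
open import Data.Nat.Divisibility using (_∣_; divides; m≤n⇒m!∣n!; m∣m*n; ∣-trans)
open import Data.Product using (∃; _×_; _,_; proj₁; proj₂)
open import Data.Rational as ℚ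
  using (ℚ; 0ℚ; 1ℚ; ½; _/_; 1/_; _⊓_; Positive; NonNegative)
import Data.Rational.Properties as ℚ
open import Data.Sum using (_⊎_; inj₁; inj₂)
import Data.Sum as Sum
open import Data.Vec using (Vec; tabulate; count)
open import Function using (_∘_)
open import Function.Bundles using (Inverse)
open import Relation.Binary.Definitions using (Decidable; tri<; tri≈; tri>)
open import Relation.Binary.PropositionalEquality as ≡
  using (_≡_; cong; subst; subst₂)
open import Relation.Nullary using (¬_; yes; no; map′; _×-dec_; contradiction)
open import Relation.Unary using (Pred) renaming (Decidable to Decidable₁)

-- Real numbers as located two-sided Dedekind cuts of ℚ.
record ℝ : Set₁ where
  field
    lower : Pred ℚ 0ℓ
    upper : Pred ℚ 0ℓ
    lower-inhabited : ∃ lower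
    upper-inhabited : ∃ upper
    lower-down : ∀ {p q} → p ℚ.< q → lower q → lower p
    upper-up   : ∀ {p q} → p ℚ.< q → upper p → upper q
    lower-open : ∀ {p} → lower p → ∃ λ q → p ℚ.< q × lower q
    upper-open : ∀ {q} → upper q → ∃ λ p → p ℚ.< q × upper p
    disjoint   : ∀ {q} → lower q → ¬ upper q
    located    : ∀ {p q} → p ℚ.< q → lower p ⊎ upper q

open ℝ

infix 4 _≤ᵣ_

_≤ᵣ_ : ℝ → ℝ → Set
x ≤ᵣ y = ∀ {q} → lower x q → lower y q

private

  lower<upper : ∀ x {p q} → lower x p → upper x q → p ℚ.< q
  lower<upper x {p} {q} l u with ℚ.<-cmp p q
  ... | tri< p<q _ _ = p<q
  ... | tri≈ _ ≡.refl _ = ⊥-elim (disjoint x l u)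
  ... | tri> _ _ q<p =
    ⊥-elim (disjoint x l (upper-up x q<p u))

  below : ∀ p → ∃ λ q → q ℚ.< p
  below p = p ℚ.- 1ℚ ,
    subst (p ℚ.- 1ℚ ℚ.<_) (ℚ.+-identityʳ p) (ℚ.+-monoʳ-< p (ℚ.negative⁻¹ (ℚ.- 1ℚ)))

  above : ∀ p → ∃ λ q → p ℚ.< q
  above p = p ℚ.+ 1ℚ ,
    subst (ℚ._< p ℚ.+ 1ℚ) (ℚ.+-identityʳ p) (ℚ.+-monoʳ-< p (ℚ.positive⁻¹ 1ℚ))

fromℚ : ℚ → ℝ
fromℚ x = record
  { lower = ℚ._< x
  ; upper = x ℚ.<_
  ; lower-inhabited = below x
  ; upper-inhabited = above x
  ; lower-down = ℚ.<-trans
  ; upper-up = λ p<q x<p → ℚ.<-trans x<p p<q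
  ; lower-open = λ p<x → let m , p<m , m<x = ℚ.<-dense p<x in m , p<m , m<x
  ; upper-open = λ x<q → let m , x<m , m<q = ℚ.<-dense x<q in m , m<q , x<m
  ; disjoint = ℚ.<-asym
  ; located = loc
  }
  where
  loc : ∀ {p q} → p ℚ.< q → p ℚ.< x ⊎ x ℚ.< q
  loc {p} {q} p<q with p ℚ.<? x
  ... | yes p<x = inj₁ p<x
  ... | no  p≮x = inj₂ (ℚ.≤-<-trans (ℚ.≮⇒≥ p≮x) p<q)

private

  p-[p-q]≡q : ∀ p q → p ℚ.- (p ℚ.- q) ≡ q
  p-[p-q]≡q p q = ≡.trans (cong (p ℚ.+_) (⁻¹-anti-homo-// p q))
    (≡.trans (ℚ.+-comm p (q ℚ.- p)) (//-rightDividesˡ p q))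
    where open GroupProperties ℚ.+-0-group

  -‿anti : ∀ p {q r} → q ℚ.< r → p ℚ.- r ℚ.< p ℚ.- q
  -‿anti p q<r = ℚ.+-monoʳ-< p (ℚ.neg-antimono-< q<r)

  swapˡ : ∀ p {q r} → r ℚ.< p ℚ.- q → q ℚ.< p ℚ.- r
  swapˡ p {q} {r} h = subst (ℚ._< p ℚ.- r) (p-[p-q]≡q p q) (-‿anti p h)

  swapʳ : ∀ p {q r} → p ℚ.- q ℚ.< r → p ℚ.- r ℚ.< q
  swapʳ p {q} {r} h = subst (p ℚ.- r ℚ.<_) (p-[p-q]≡q p q) (-‿anti p h)

infixl 6 _-ᵣ_

_-ᵣ_ : ℚ → ℝ → ℝ
p -ᵣ x = record
  { lower = λ q → upper x (p ℚ.- q)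
  ; upper = λ q → lower x (p ℚ.- q)
  ; lower-inhabited = let u , h = upper-inhabited x in
      p ℚ.- u , subst (upper x) (≡.sym (p-[p-q]≡q p u)) h
  ; upper-inhabited = let l , h = lower-inhabited x in
      p ℚ.- l , subst (lower x) (≡.sym (p-[p-q]≡q p l)) h
  ; lower-down = λ q<r → upper-up x (-‿anti p q<r)
  ; upper-up = λ q<r → lower-down x (-‿anti p q<r)
  ; lower-open = λ h → let r , r<p-q , u = upper-open x h in
      p ℚ.- r , swapˡ p r<p-q , subst (upper x) (≡.sym (p-[p-q]≡q p r)) u
  ; upper-open = λ h → let r , p-q<r , l = lower-open x h in
      p ℚ.- r , swapʳ p p-q<r , subst (lower x) (≡.sym (p-[p-q]≡q p r)) l
  ; disjoint = λ u l → disjoint x l u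
  ; located = λ q<r → Sum.swap (located x (-‿anti p q<r))
  }

private

  square-mono : ∀ {p q} → 0ℚ ℚ.≤ p → p ℚ.< q → p ℚ.* p ℚ.< q ℚ.* q
  square-mono {p} {q} 0≤p p<q =
    ℚ.≤-<-trans (ℚ.*-monoˡ-≤-nonNeg p (ℚ.<⇒≤ p<q))
                (ℚ.*-monoˡ-<-pos q p<q)
    where instance
      _ = ℚ.nonNegative 0≤p
      _ = ℚ.positive (ℚ.≤-<-trans 0≤p p<q)

  x≤[x+1]² : ∀ x → 0ℚ ℚ.≤ x → x ℚ.≤ (x ℚ.+ 1ℚ) ℚ.* (x ℚ.+ 1ℚ)
  x≤[x+1]² x 0≤x = begin
    x                                ≤⟨ ℚ.<⇒≤ (proj₂ (above x)) ⟩
    y                                ≡⟨ ℚ.*-identityʳ y ⟨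
    y ℚ.* 1ℚ                         ≤⟨ ℚ.*-monoˡ-≤-nonNeg y 1≤y ⟩
    y ℚ.* y                          ∎
    where
    open ℚ.≤-Reasoning
    y = x ℚ.+ 1ℚ
    1≤y : 1ℚ ℚ.≤ y
    1≤y = subst (ℚ._≤ y) (ℚ.+-identityˡ 1ℚ) (ℚ.+-monoˡ-≤ 1ℚ 0≤x)
    instance _ = ℚ.nonNegative (ℚ.≤-trans (ℚ.nonNegative⁻¹ 1ℚ) 1≤y)

-- √ x = sup { r | r² ≤ x } = inf { r ≥ 0 | x ≤ r² }.
√ : (x : ℚ) .{{_ : NonNegative x}} → ℝ
√ x = record
  { lower = λ q → ∃ λ r → q ℚ.< r × r ℚ.* r ℚ.≤ x
  ; upper = λ q → ∃ λ r → r ℚ.< q × 0ℚ ℚ.≤ r × x ℚ.≤ r ℚ.* r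
  ; lower-inhabited = let q , q<0 = below 0ℚ in q , 0ℚ , q<0 , 0≤x
  ; upper-inhabited = let q , x+1<q = above (x ℚ.+ 1ℚ) in
      q , x ℚ.+ 1ℚ , x+1<q ,
      ℚ.≤-trans 0≤x (ℚ.<⇒≤ (proj₂ (above x))) , x≤[x+1]² x 0≤x
  ; lower-down = λ { p<q (r , q<r , h) → r , ℚ.<-trans p<q q<r , h }
  ; upper-up = λ { p<q (r , r<p , h) → r , ℚ.<-trans r<p p<q , h }
  ; lower-open = λ { (r , q<r , h) →
      let m , q<m , m<r = ℚ.<-dense q<r in m , q<m , r , m<r , h }
  ; upper-open = λ { (r , r<q , h) →
      let m , r<m , m<q = ℚ.<-dense r<q in m , m<q , r , r<m , h }
  ; disjoint = λ { (r , q<r , r²≤x) (s , s<q , 0≤s , x≤s²) →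
      ℚ.<-irrefl ≡.refl (ℚ.<-≤-trans (square-mono 0≤s (ℚ.<-trans s<q q<r))
                                     (ℚ.≤-trans r²≤x x≤s²)) }
  ; located = loc
  }
  where
  0≤x : 0ℚ ℚ.≤ x
  0≤x = ℚ.nonNegative⁻¹ x

  loc : ∀ {p q} → p ℚ.< q →
        (∃ λ r → p ℚ.< r × r ℚ.* r ℚ.≤ x) ⊎
        (∃ λ r → r ℚ.< q × 0ℚ ℚ.≤ r × x ℚ.≤ r ℚ.* r)
  loc p<q with ℚ.<-dense p<q
  ... | m , p<m , m<q with 0ℚ ℚ.≤? m | ℚ.≤-total (m ℚ.* m) x
  ...   | no 0≰m  | _         = inj₁ (0ℚ , ℚ.<-trans p<m (ℚ.≰⇒> 0≰m) , 0≤x)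
  ...   | yes _   | inj₁ m²≤x = inj₁ (m , p<m , m²≤x)
  ...   | yes 0≤m | inj₂ x≤m² = inj₂ (m , m<q , 0≤m , x≤m²)

√-pos : ∀ x .{{_ : Positive x}} → lower (√ x {{ℚ.pos⇒nonNeg x}}) 0ℚ
√-pos x = r , 0<r , (begin
  r ℚ.* r   ≤⟨ ℚ.*-monoˡ-≤-nonNeg r (ℚ.p⊓q≤q x 1ℚ) ⟩
  r ℚ.* 1ℚ  ≡⟨ ℚ.*-identityʳ r ⟩
  r         ≤⟨ ℚ.p⊓q≤p x 1ℚ ⟩
  x         ∎)
  where
  open ℚ.≤-Reasoning
  r = x ⊓ 1ℚ
  0<r : 0ℚ ℚ.< r
  0<r with ℚ.⊓-sel x 1ℚ
  ... | inj₁ r≡x = subst (0ℚ ℚ.<_) (≡.sym r≡x) (ℚ.positive⁻¹ x)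
  ... | inj₂ r≡1 = subst (0ℚ ℚ.<_) (≡.sym r≡1) (ℚ.positive⁻¹ 1ℚ)
  instance _ = ℚ.nonNegative (ℚ.<⇒≤ 0<r)

private

  module Division (r : ℚ) (0<r : 0ℚ ℚ.< r) where
    instance
      r-pos : Positive r
      r-pos = ℚ.positive 0<r
      r-nonNeg : NonNegative r
      r-nonNeg = ℚ.pos⇒nonNeg r
      r-nonZero : ℚ.NonZero r
      r-nonZero = ℚ.pos⇒nonZero r

    _÷r : ℚ → ℚ
    p ÷r = p ℚ.* 1/ r

    ÷-* : ∀ p → (p ÷r) ℚ.* r ≡ p
    ÷-* p = ≡.trans (ℚ.*-assoc p (1/ r) r)
            (≡.trans (cong (p ℚ.*_) (ℚ.*-inverseˡ r)) (ℚ.*-identityʳ p))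

    <-÷ : ∀ {p q} → p ℚ.* r ℚ.< q → p ℚ.< q ÷r
    <-÷ {p} {q} h = ℚ.*-cancelʳ-<-nonNeg r (subst (p ℚ.* r ℚ.<_) (≡.sym (÷-* q)) h)

    ÷-< : ∀ {p q} → q ℚ.< p ℚ.* r → q ÷r ℚ.< p
    ÷-< {p} {q} h = ℚ.*-cancelʳ-<-nonNeg r (subst (ℚ._< p ℚ.* r) (≡.sym (÷-* q)) h)

    0<÷ : 0ℚ ℚ.< 1ℚ ÷r
    0<÷ = <-÷ (subst (ℚ._< 1ℚ) (≡.sym (ℚ.*-zeroˡ r)) (ℚ.positive⁻¹ 1ℚ))

    *-mono : ∀ {p q} → p ℚ.< q → p ℚ.* r ℚ.< q ℚ.* r
    *-mono = ℚ.*-monoˡ-<-pos r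

-- The reciprocal of a positive real: q < 1 / x iff q * r < 1 for some r > x,
-- and 1 / x < q iff 1 < q * r for some 0 < r < x.
_⁻¹ᵣ : (x : ℝ) → {{lower x 0ℚ}} → ℝ
_⁻¹ᵣ x {{0<x}} = record
  { lower = L
  ; upper = U
  ; lower-inhabited = let u , h = upper-inhabited x in
      0ℚ , u , h , subst (ℚ._< 1ℚ) (≡.sym (ℚ.*-zeroˡ u)) (ℚ.positive⁻¹ 1ℚ)
  ; upper-inhabited = let l , 0<l , h = lower-open x 0<x
                          open Division l 0<l
                          q , 1/l<q = above (1ℚ ÷r) in
      q , l , 0<l , h , subst (ℚ._< q ℚ.* l) (÷-* 1ℚ) (*-mono 1/l<q)
  ; lower-down = λ { p<q (r , u , qr<1) →
      r , u , ℚ.<-trans (Division.*-mono r (lower<upper x 0<x u) p<q) qr<1 }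
  ; upper-up = λ { p<q (r , 0<r , l , 1<pr) →
      r , 0<r , l , ℚ.<-trans 1<pr (Division.*-mono r 0<r p<q) }
  ; lower-open = λ { (r , u , qr<1) →
      let open Division r (lower<upper x 0<x u)
          m , qr<m , m<1 = ℚ.<-dense qr<1 in
      m ÷r , <-÷ qr<m , r , u , subst (ℚ._< 1ℚ) (≡.sym (÷-* m)) m<1 }
  ; upper-open = λ { (r , 0<r , l , 1<qr) →
      let open Division r 0<r
          m , 1<m , m<qr = ℚ.<-dense 1<qr in
      m ÷r , ÷-< m<qr , r , 0<r , l , subst (1ℚ ℚ.<_) (≡.sym (÷-* m)) 1<m }
  ; disjoint = λ {q} → disj {q}
  ; located = loc
  }
  where
  L U : Pred ℚ 0ℓ
  L q = ∃ λ r → upper x r × q ℚ.* r ℚ.< 1ℚ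
  U q = ∃ λ r → 0ℚ ℚ.< r × lower x r × 1ℚ ℚ.< q ℚ.* r

  disj : ∀ {q} → L q → ¬ U q
  disj {q} (s , us , qs<1) (t , 0<t , lt , 1<qt) =
    ℚ.<-asym (ℚ.<-trans qs<1 1<qt) (ℚ.*-monoʳ-<-pos q (lower<upper x lt us))
    where
    0*t<q*t : 0ℚ ℚ.* t ℚ.< q ℚ.* t
    0*t<q*t = subst (ℚ._< q ℚ.* t) (≡.sym (ℚ.*-zeroˡ t))
                (ℚ.<-trans (ℚ.positive⁻¹ 1ℚ) 1<qt)
    instance
      _ = ℚ.pos⇒nonNeg t {{ℚ.positive 0<t}}
      _ = ℚ.positive (ℚ.*-cancelʳ-<-nonNeg t {0ℚ} {q} 0*t<q*t)

  loc : ∀ {p q} → p ℚ.< q → L p ⊎ U q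
  loc {p} {q} p<q with 0ℚ ℚ.<? p
  ... | no 0≮p = let u , h = upper-inhabited x in inj₁ (u , h , (begin-strict
        p ℚ.* u   ≤⟨ ℚ.*-monoʳ-≤-nonNeg u {{ℚ.nonNegative (ℚ.<⇒≤ (lower<upper x 0<x h))}}
                       (ℚ.≮⇒≥ 0≮p) ⟩
        0ℚ ℚ.* u  ≡⟨ ℚ.*-zeroˡ u ⟩
        0ℚ        <⟨ ℚ.positive⁻¹ 1ℚ ⟩
        1ℚ        ∎))
    where open ℚ.≤-Reasoning
  ... | yes 0<p = result
    where
    0<q : 0ℚ ℚ.< q
    0<q = ℚ.<-trans 0<p p<q
    module P = Division p 0<p
    module Q = Division q 0<q
    1/q<1/p : (1ℚ Q.÷r) ℚ.< (1ℚ P.÷r)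
    1/q<1/p = P.<-÷ (subst ((1ℚ Q.÷r) ℚ.* p ℚ.<_) (Q.÷-* 1ℚ)
      (ℚ.*-monoʳ-<-pos (1ℚ Q.÷r) {{ℚ.positive Q.0<÷}} p<q))
    result : L p ⊎ U q
    result with ℚ.<-dense 1/q<1/p
    ... | a , 1/q<a , a<1/p with ℚ.<-dense a<1/p
    ...   | b , a<b , b<1/p with located x a<b
    ...     | inj₁ la = inj₂ (a , ℚ.<-trans Q.0<÷ 1/q<a , la ,
                subst₂ ℚ._<_ (Q.÷-* 1ℚ) (ℚ.*-comm a q) (Q.*-mono 1/q<a))
    ...     | inj₂ ub = inj₁ (b , ub ,
                subst₂ ℚ._<_ (ℚ.*-comm b p) (P.÷-* 1ℚ) (P.*-mono b<1/p))

1/√_ : (m : ℕ) .{{_ : NonZero m}} → ℝ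
1/√ m = _⁻¹ᵣ (√ (+ m / 1) {{ℚ.pos⇒nonNeg (+ m / 1)}}) {{√-pos (+ m / 1)}}
  where instance
    m/1-pos : Positive (+ m / 1)
    m/1-pos = ℚ.normalize-pos m 1

private

  leastWitness : ∀ {p} {P : Pred ℕ p} → Decidable₁ P → ∀ k → P k →
                 ∃ λ m → P m × (∀ {j} → P j → m ℕ.≤ j)
  leastWitness P? k pk with P? 0
  ... | yes p0 = 0 , p0 , λ _ → ℕ.z≤n
  leastWitness P? zero pk    | no ¬p0 = contradiction pk ¬p0
  leastWitness {P = P} P? (suc k) pk | no ¬p0
    with m , pm , least ← leastWitness (P? ∘ suc) k pk = suc m , pm , least′
    where
    least′ : ∀ {j} → P j → suc m ℕ.≤ j
    least′ {zero}  pj = contradiction pj ¬p0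
    least′ {suc j} pj = ℕ.s≤s (least pj)

record FiniteGroup (c r : Level) : Set (lsuc (c ⊔ r)) where
  -- A group on a setoid whose _≈_-classes are enumerated by Fin order.
  field
    group       : Group c r
    order       : ℕ
    enumeration : Inverse (≡.setoid (Fin order)) (Group.setoid group)

  open Group group public
  open GroupProperties group using (identityʳ-unique)
  -- The library writes k × g for the k-fold product g ∙ … ∙ g.
  open import Algebra.Properties.Monoid.Mult monoid
    using (×-congʳ; ×-homo-+; ×-assocˡ) renaming (_×_ to _×ᴹ_)
  private module E = Inverse enumeration

  infix 4 _≟_

  _≟_ : Decidable _≈_
  g ≟ h = map′ from-injective E.from-cong (E.from g Fin.≟ E.from h)
    where
    from-injective : E.from g ≡ E.from h → g ≈ h
    from-injective eq =
      trans (sym (E.strictlyInverseˡ g))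
            (trans (E.to-cong eq) (E.strictlyInverseˡ h))

  instance
    order-nonZero : NonZero order
    order-nonZero = Fin.nonZeroIndex (E.from ε)

    2*order-nonZero : NonZero (2 ℕ.* order)
    2*order-nonZero = ℕ.m*n≢0 2 order

  -- Every element, up to _≈_, exactly once.
  elements : Vec Carrier order
  elements = tabulate E.to

  -- The number of elements satisfying P, for P respecting _≈_.
  ∣_∣ : ∀ {p} {P : Pred Carrier p} → Decidable₁ P → ℕ
  ∣ P? ∣ = count P? elements

  infixr 8 _^_

  _^_ : Carrier → ℤ → Carrier
  g ^ (+ k)    = k ×ᴹ g
  g ^ -[1+ k ] = (suc k ×ᴹ g) ⁻¹

  Kills : ℕ → Set (c ⊔ r)
  Kills k = NonZero k × (∀ g → g ^ + k ≈ ε)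

  -- The least positive e with g ^ e ≈ ε for all g.
  IsExponent : ℕ → Set (c ⊔ r)
  IsExponent e = Kills e × (∀ {k} → Kills k → e ℕ.≤ k)

  private

    kills-multiple : ∀ {k l g} → k ∣ l → k ×ᴹ g ≈ ε → l ×ᴹ g ≈ ε
    kills-multiple {k} {_} {g} (divides q ≡.refl) h =
      trans (sym (×-assocˡ g q k)) (trans (×-congʳ q h) (×-ε q))
      where
      ×-ε : ∀ n → n ×ᴹ ε ≈ ε
      ×-ε zero    = refl
      ×-ε (suc n) = trans (identityˡ _) (×-ε n)

    order!-kills : ∀ g → (order !) ×ᴹ g ≈ ε
    order!-kills g
      with i , j , i<j , eq ← Fin.pigeonhole (ℕ.n<1+n order)
             (λ (i : Fin (suc order)) → E.from (toℕ i ×ᴹ g))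
      with toℕ j ℕ.∸ toℕ i in d≡
    ... | zero = contradiction d≡ (ℕ.m>n⇒m∸n≢0 i<j)
    ... | suc d = kills-multiple {suc d}
            (∣-trans (m∣m*n (d !)) (m≤n⇒m!∣n! d<order))
            (identityʳ-unique (toℕ i ×ᴹ g) _ (trans (sym (×-homo-+ g (toℕ i) (suc d))) same))
      where
      i+d≡j : toℕ i ℕ.+ suc d ≡ toℕ j
      i+d≡j = ≡.trans (cong (toℕ i ℕ.+_) (≡.sym d≡)) (ℕ.m+[n∸m]≡n (ℕ.<⇒≤ i<j))
      d<order : suc d ℕ.≤ order
      d<order = ℕ.≤-trans (ℕ.m≤n+m (suc d) (toℕ i))
                (subst (ℕ._≤ order) (≡.sym i+d≡j) (ℕ.s≤s⁻¹ (Fin.toℕ<n j)))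
      same : (toℕ i ℕ.+ suc d) ×ᴹ g ≈ toℕ i ×ᴹ g
      same = trans (reflexive (cong (_×ᴹ g) i+d≡j))
             (trans (sym (E.strictlyInverseˡ _))
             (trans (E.to-cong (≡.sym eq)) (E.strictlyInverseˡ _)))

    exponent-exists : ∃ IsExponent
    exponent-exists = leastWitness kills? (order !) (ℕ._!≢0 order , order!-kills)
      where
      kills? : Decidable₁ Kills
      kills? k = ℕ.nonZero? k ×-dec map′
        (λ h g → trans (×-congʳ k (sym (E.strictlyInverseˡ g))) (h (E.from g)))
        (λ h i → h (E.to i))
        (Fin.all? (λ i → k ×ᴹ E.to i ≟ ε))

  exponent : ℕ
  exponent = proj₁ exponent-exists

  exponent-isExponent : IsExponent exponent
  exponent-isExponent = proj₂ exponent-exists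

{-# OPTIONS --safe #-}

-- Let k = ∣ ℓ ∣ and call x bad if x ^ k ≠ 1; let t be the number of bad elements.
-- Some g is bad, hence so are all its conjugates.  If h centralises g then
-- (g h) ^ k = g ^ k h ^ k, so h or g h is bad; therefore the centraliser of g has
-- at most 2 t elements, and n ≤ t · 2 t by orbit–stabiliser.  Thus t / n ≥ 1/√(2 n).
module Submission where

open import Defs
open import Algebra.Bundles using (Group)
import Algebra.Properties.Group as GroupProperties
import Algebra.Properties.Monoid.Mult as MonoidMult
open import Data.Bool using (true; false)
open import Data.Fin using (Fin; zero; suc; combine; join; splitAt)
import Data.Fin.Properties as Fin
open import Data.Integer using (ℤ; +_; -[1+_])
import Data.Integer as ℤ
import Data.Integer.Properties as ℤ
open import Data.Integer.Divisibility using (_∣_)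
open import Data.Nat using (ℕ; zero; suc; NonZero; _+_; _*_; _≤_)
import Data.Nat as ℕ
import Data.Nat.Properties as ℕ
import Data.Nat.Divisibility as ℕ
open import Data.Nat.Solver using (module +-*-Solver)
open import Data.Nat.DivMod using (_%_; m%n<n; m≡m%n+[m/n]*n)
open import Data.Product using (∃; _,_; proj₁; proj₂)
open import Data.Rational using (1ℚ; _/_; 1/_; fromℚᵘ; toℚᵘ; Positive)
import Data.Rational as ℚ
import Data.Rational.Properties as ℚ
open import Data.Rational.Unnormalised as ℚᵘ using (mkℚᵘ; *≡*; *≤*)
import Data.Rational.Unnormalised.Properties as ℚᵘ
open import Data.Sum using (_⊎_; inj₁; inj₂)
open import Data.Sum.Properties using (inj₁-injective; inj₂-injective)
open import Data.Vec using (Vec; []; _∷_; count; tabulate)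
open import Function using (_∘_)
open import Function.Bundles using (Inverse)
open import Function.Definitions using (Injective)
open import Relation.Binary.PropositionalEquality as ≡ using (_≡_; cong; subst)
open import Relation.Nullary using (¬_; ¬?; yes; no; does; contradiction)
open import Relation.Nullary.Decidable using (decidable-stable)
open import Relation.Unary using (Pred; Decidable)

-- Counting by injections, and choosing preimages.

module _ {a p} {A : Set a} {P : Pred A p} (P? : Decidable P) where

  count-complement : ∀ {n} (xs : Vec A n) → count P? xs + count (¬? ∘ P?) xs ≡ n
  count-complement []       = ≡.refl
  count-complement (x ∷ xs) with does (P? x)
  ... | true  = cong suc (count-complement xs)
  ... | false = ≡.trans (ℕ.+-suc _ _) (cong suc (count-complement xs))

  -- The position of `f i` among the entries satisfying `P`. It makes a `count` the size of a `Fin`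
  -- type into which injections can be built.
  rank : ∀ {n} (f : Fin n → A) i → P (f i) → Fin (count P? (tabulate f))
  rank f zero    p with P? (f zero)
  ... | yes _ = zero
  ... | no ¬p = contradiction p ¬p
  rank f (suc i) p with P? (f zero)
  ... | yes _ = suc (rank (f ∘ suc) i p)
  ... | no  _ = rank (f ∘ suc) i p

  -- The proofs `p` and `q` may differ, since `rank` uses its proof only to refute the `no` branch.
  rank-injective : ∀ {n} (f : Fin n → A) i j {p q} → rank f i p ≡ rank f j q → i ≡ j
  rank-injective f zero    zero    eq = ≡.refl
  rank-injective f zero    (suc j) {p} eq with P? (f zero)
  rank-injective f zero    (suc j) {p} () | yes _
  ... | no ¬p = contradiction p ¬p
  rank-injective f (suc i) zero    {q = q} eq with P? (f zero)
  rank-injective f (suc i) zero    {q = q} () | yes _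
  ... | no ¬p = contradiction q ¬p
  rank-injective f (suc i) (suc j) eq with P? (f zero)
  ... | yes _ = cong suc (rank-injective (f ∘ suc) i j (Fin.suc-injective eq))
  ... | no  _ = cong suc (rank-injective (f ∘ suc) i j eq)

join-injective : ∀ {m n} {x y : Fin m ⊎ Fin n} → join m n x ≡ join m n y → x ≡ y
join-injective {m} {n} {x} {y} eq = ≡.trans (≡.sym (Fin.splitAt-join m n x))
  (≡.trans (cong (splitAt m) eq) (Fin.splitAt-join m n y))

module _ {n} (f : Fin n → Fin n) where

  -- A junk value off the image of f.
  preimage : Fin n → Fin n
  preimage v with Fin.any? (λ j → f j Fin.≟ v)
  ... | yes (j , _) = j
  ... | no  _       = v

  -- The chosen index may differ from `i`, but it depends only on `f i`, so it serves as a
  -- representative of the fibre containing `i`.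
  preimage-correct : ∀ i → f (preimage (f i)) ≡ f i
  preimage-correct i with Fin.any? (λ j → f j Fin.≟ f i)
  ... | yes (_ , eq) = eq
  ... | no  ∄j       = contradiction (i , ≡.refl) ∄j

-- Powers of conjugates and of products of commuting elements.

module _ {c r} (G : Group c r) where
  open Group G
  open GroupProperties G
  open MonoidMult monoid using (_×_; ×-congʳ)
  open import Relation.Binary.Reasoning.Setoid setoid

  -- This is the power rule for conjugates with the trailing inverse cleared, so that the induction
  -- only has to carry `x` past one factor at a time.
  conjugate-×-commute : ∀ k x g → k × (x ∙ g // x) ∙ x ≈ x ∙ k × g
  conjugate-×-commute zero    x g = trans (identityˡ x) (sym (identityʳ x))
  conjugate-×-commute (suc k) x g = begin
    (x ∙ g // x) ∙ k × (x ∙ g // x) ∙ x    ≈⟨ assoc _ _ _ ⟩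
    (x ∙ g // x) ∙ (k × (x ∙ g // x) ∙ x)  ≈⟨ ∙-congˡ (conjugate-×-commute k x g) ⟩
    (x ∙ g // x) ∙ (x ∙ k × g)             ≈⟨ assoc _ _ _ ⟨
    (x ∙ g // x) ∙ x ∙ k × g               ≈⟨ ∙-congʳ (//-rightDividesˡ x (x ∙ g)) ⟩
    x ∙ g ∙ k × g                          ≈⟨ assoc _ _ _ ⟩
    x ∙ (g ∙ k × g)                        ∎

  commute-× : ∀ k {g h} → h ∙ g ≈ g ∙ h → h ∙ k × g ≈ k × g ∙ h
  commute-× zero            hg≈gh = trans (identityʳ _) (sym (identityˡ _))
  commute-× (suc k) {g} {h} hg≈gh = begin
    h ∙ (g ∙ k × g)  ≈⟨ assoc _ _ _ ⟨
    h ∙ g ∙ k × g    ≈⟨ ∙-congʳ hg≈gh ⟩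
    g ∙ h ∙ k × g    ≈⟨ assoc _ _ _ ⟩
    g ∙ (h ∙ k × g)  ≈⟨ ∙-congˡ (commute-× k hg≈gh) ⟩
    g ∙ (k × g ∙ h)  ≈⟨ assoc _ _ _ ⟨
    g ∙ k × g ∙ h    ∎

  ×-distrib-∙ : ∀ k {g h} → h ∙ g ≈ g ∙ h → k × (g ∙ h) ≈ k × g ∙ k × h
  ×-distrib-∙ zero            hg≈gh = sym (identityˡ ε)
  ×-distrib-∙ (suc k) {g} {h} hg≈gh = begin
    g ∙ h ∙ k × (g ∙ h)        ≈⟨ ∙-congˡ (×-distrib-∙ k hg≈gh) ⟩
    g ∙ h ∙ (k × g ∙ k × h)    ≈⟨ assoc _ _ _ ⟨
    g ∙ h ∙ k × g ∙ k × h      ≈⟨ ∙-congʳ (assoc _ _ _) ⟩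
    g ∙ (h ∙ k × g) ∙ k × h    ≈⟨ ∙-congʳ (∙-congˡ (commute-× k hg≈gh)) ⟩
    g ∙ (k × g ∙ h) ∙ k × h    ≈⟨ ∙-congʳ (assoc _ _ _) ⟨
    g ∙ k × g ∙ h ∙ k × h      ≈⟨ assoc _ _ _ ⟩
    g ∙ k × g ∙ (h ∙ k × h)    ∎

  -- The half of orbit-stabiliser that is needed: a fibre of the conjugation map lies in one left
  -- coset of the centraliser of `g`.
  conjugates-agree⇒commute : ∀ {x y g} → x ∙ g // x ≈ y ∙ g // y →
                             (y \\ x) ∙ g ≈ g ∙ (y \\ x)
  conjugates-agree⇒commute {x} {y} {g} eq = begin
    y ⁻¹ ∙ x ∙ g                    ≈⟨ assoc _ _ _ ⟩
    y ⁻¹ ∙ (x ∙ g)                  ≈⟨ ∙-congˡ (//-rightDividesˡ x (x ∙ g)) ⟨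
    y ⁻¹ ∙ ((x ∙ g // x) ∙ x)       ≈⟨ ∙-congˡ (∙-congʳ eq) ⟩
    y ⁻¹ ∙ ((y ∙ g // y) ∙ x)       ≈⟨ ∙-congˡ (assoc _ _ _) ⟩
    y ⁻¹ ∙ (y ∙ g ∙ (y ⁻¹ ∙ x))     ≈⟨ ∙-congˡ (assoc _ _ _) ⟩
    y ⁻¹ ∙ (y ∙ (g ∙ (y ⁻¹ ∙ x)))   ≈⟨ \\-leftDividesʳ y _ ⟩
    g ∙ (y ⁻¹ ∙ x)                  ∎

  -- The hypothesis turns `conjugate-×-commute` into `x ∙ k × g ≈ x`, and cancelling `x` leaves
  -- `k × g ≈ ε`.
  ×-conjugate-≈ε : ∀ k {x g} → k × (x ∙ g // x) ≈ ε → k × g ≈ ε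
  ×-conjugate-≈ε k {x} {g} eq = identityʳ-unique x (k × g) (begin
    x ∙ k × g               ≈⟨ conjugate-×-commute k x g ⟨
    k × (x ∙ g // x) ∙ x    ≈⟨ ∙-congʳ eq ⟩
    ε ∙ x                   ≈⟨ identityˡ x ⟩
    x                       ∎)

  ×-factor-≈ε : ∀ k {g h} → h ∙ g ≈ g ∙ h → k × (g ∙ h) ≈ ε → k × h ≈ ε → k × g ≈ ε
  ×-factor-≈ε k {g} {h} hg≈gh kgh≈ε kh≈ε = begin
    k × g            ≈⟨ identityʳ _ ⟨
    k × g ∙ ε        ≈⟨ ∙-congˡ kh≈ε ⟨
    k × g ∙ k × h    ≈⟨ ×-distrib-∙ k hg≈gh ⟨
    k × (g ∙ h)      ≈⟨ kgh≈ε ⟩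
    ε                ∎

-- The exponent and the bad elements of a finite group.

module _ {c r} (G : FiniteGroup c r) where
  open FiniteGroup G
  open GroupProperties group
  open MonoidMult monoid using (_×_; ×-congʳ; ×-homo-+; ×-assocˡ)
  open Inverse enumeration using (to; from; from-cong; to-cong; strictlyInverseˡ; strictlyInverseʳ)
  open import Relation.Binary.Reasoning.Setoid setoid

  from-injective : ∀ {g h} → from g ≡ from h → g ≈ h
  from-injective {g} {h} eq = begin
    g            ≈⟨ strictlyInverseˡ g ⟨
    to (from g)  ≈⟨ to-cong eq ⟩
    to (from h)  ≈⟨ strictlyInverseˡ h ⟩
    h            ∎

  to-injective : ∀ {i j} → to i ≈ to j → i ≡ j
  to-injective {i} {j} eq =
    ≡.trans (≡.sym (strictlyInverseʳ i)) (≡.trans (from-cong eq) (strictlyInverseʳ j))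

  -- A negative exponent only inverts the power, and an inverse is `ε` exactly when the element is.
  -- So everything can be argued for natural powers.
  ^≈ε⇒×≈ε : ∀ ℓ {g} → g ^ ℓ ≈ ε → ℤ.∣ ℓ ∣ × g ≈ ε
  ^≈ε⇒×≈ε (+ k)    eq = eq
  ^≈ε⇒×≈ε -[1+ k ] eq = ⁻¹-injective (trans eq (sym ε⁻¹≈ε))

  ×≈ε⇒^≈ε : ∀ ℓ {g} → ℤ.∣ ℓ ∣ × g ≈ ε → g ^ ℓ ≈ ε
  ×≈ε⇒^≈ε (+ k)    eq = eq
  ×≈ε⇒^≈ε -[1+ k ] eq = trans (⁻¹-cong eq) ε⁻¹≈ε

  ×ε≈ε : ∀ k → k × ε ≈ ε
  ×ε≈ε zero    = refl
  ×ε≈ε (suc k) = trans (identityˡ _) (×ε≈ε k)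

  -- The remainder `k % e` also annihilates every element; were it nonzero, it would contradict the
  -- minimality of `e`.
  exponent-divides : ∀ k → (∀ g → k × g ≈ ε) → exponent ℕ.∣ k
  exponent-divides k k-kills =
    ℕ.m%n≡0⇒n∣m k e (decidable-stable (k % e ℕ.≟ 0) λ k%e≢0 →
      ℕ.<⇒≱ (m%n<n k e) (proj₂ exponent-isExponent (ℕ.≢-nonZero k%e≢0 , k%e-kills)))
    where
    e = exponent
    e-kills : Kills e
    e-kills = proj₁ exponent-isExponent
    instance e-nonZero = proj₁ e-kills
    k%e-kills : ∀ g → (k % e) × g ≈ ε
    k%e-kills g = begin
      (k % e) × g                        ≈⟨ identityʳ _ ⟨
      (k % e) × g ∙ ε                    ≈⟨ ∙-congˡ (×ε≈ε (k ℕ./ e)) ⟨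
      (k % e) × g ∙ (k ℕ./ e) × ε        ≈⟨ ∙-congˡ (×-congʳ (k ℕ./ e) (proj₂ e-kills g)) ⟨
      (k % e) × g ∙ (k ℕ./ e) × (e × g)  ≈⟨ ∙-congˡ (×-assocˡ g (k ℕ./ e) e) ⟩
      (k % e) × g ∙ (k ℕ./ e * e) × g    ≈⟨ ×-homo-+ g (k % e) (k ℕ./ e * e) ⟨
      (k % e + k ℕ./ e * e) × g          ≡⟨ cong (_× g) (m≡m%n+[m/n]*n k e) ⟨
      k × g                              ≈⟨ k-kills g ⟩
      ε                                  ∎

  module _ (ℓ : ℤ) where

    good? : Decidable (λ g → g ^ ℓ ≈ ε)
    good? g = g ^ ℓ ≟ ε

    Bad : Pred Carrier r
    Bad g = ¬ g ^ ℓ ≈ ε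

    good-resp : ∀ {g h} → g ≈ h → g ^ ℓ ≈ ε → h ^ ℓ ≈ ε
    good-resp g≈h = ×≈ε⇒^≈ε ℓ ∘ trans (×-congʳ ℤ.∣ ℓ ∣ (sym g≈h)) ∘ ^≈ε⇒×≈ε ℓ

    bad-exists : ¬ (+ exponent ∣ ℓ) → ∃ Bad
    bad-exists e∤ℓ =
      -- Goodness is decidable and the index type finite, so a bad element is found constructively.
      -- Divisibility in ℤ unfolds to divisibility of absolute values, which is what
      -- `exponent-divides` supplies.
      let i , bad = Fin.¬∀⟶∃¬ order _ (good? ∘ to) λ all-good →
            e∤ℓ (exponent-divides ℤ.∣ ℓ ∣ λ g →
              ^≈ε⇒×≈ε ℓ (good-resp (strictlyInverseˡ g) (all-good (from g))))
      in to i , bad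

    bad-conjugate : ∀ {g} x → Bad g → Bad (x ∙ g // x)
    bad-conjugate x bad =
      bad ∘ ×≈ε⇒^≈ε ℓ ∘ ×-conjugate-≈ε group ℤ.∣ ℓ ∣ ∘ ^≈ε⇒×≈ε ℓ

    bad-product : ∀ {g h} → h ∙ g ≈ g ∙ h → Bad g → h ^ ℓ ≈ ε → Bad (g ∙ h)
    bad-product hg≈gh bad good-h good-gh = bad (×≈ε⇒^≈ε ℓ
      (×-factor-≈ε group ℤ.∣ ℓ ∣ hg≈gh (^≈ε⇒×≈ε ℓ good-gh) (^≈ε⇒×≈ε ℓ good-h)))

    badCount : ℕ
    badCount = count (¬? ∘ good?) elements

    badIndex : ∀ g → Bad g → Fin badCount
    badIndex g bad =
      rank (¬? ∘ good?) to (from g) (bad ∘ good-resp (strictlyInverseˡ g))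

    badIndex-injective : ∀ {g h} bad-g bad-h → badIndex g bad-g ≡ badIndex h bad-h → g ≈ h
    badIndex-injective {g} {h} _ _ eq =
      from-injective (rank-injective (¬? ∘ good?) to (from g) (from h) eq)

    -- Orbit-stabiliser as an injective coding of the group.

    module _ {g} (bad-g : Bad g) where

      -- The tag records whether `h` or `g ∙ h` is the bad element used; untagged, distinct elements
      -- could share an index.
      centralizerIndex : ∀ h → h ∙ g ≈ g ∙ h → Fin badCount ⊎ Fin badCount
      centralizerIndex h hg≈gh with good? h
      ... | yes good = inj₂ (badIndex (g ∙ h) (bad-product hg≈gh bad-g good))
      ... | no  bad  = inj₁ (badIndex h bad)

      -- Differing tags rule out the mixed cases; when both tags are `inj₂`, the common factor `g`
      -- cancels.
      centralizerIndex-injective : ∀ {h h′} c c′ →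
        centralizerIndex h c ≡ centralizerIndex h′ c′ → h ≈ h′
      centralizerIndex-injective {h} {h′} c c′ eq with good? h | good? h′
      ... | yes good | yes good′ = ∙-cancelˡ g h h′ (badIndex-injective
        (bad-product c bad-g good) (bad-product c′ bad-g good′) (inj₂-injective eq))
      ... | no bad   | no bad′   = badIndex-injective bad bad′ (inj₁-injective eq)

      -- Conjugates are named by their indices, so that `preimage` can search for them and equal
      -- conjugates become propositionally equal.
      conjugacyClass : Fin order → Fin order
      conjugacyClass i = from (to i ∙ g // to i)

      -- When `v` indexes a conjugate of `g`, this is a fixed representative of the coset of
      -- elements conjugating `g` to it.
      base : Fin order → Carrier
      base v = to (preimage conjugacyClass v)

      offset : Fin order → Carrier
      offset i = base (conjugacyClass i) \\ to i

      offset-commutes : ∀ i → offset i ∙ g ≈ g ∙ offset i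
      offset-commutes i = conjugates-agree⇒commute group
        (sym (from-injective (preimage-correct conjugacyClass i)))

      classIndex : Fin order → Fin badCount
      classIndex i = badIndex (to i ∙ g // to i) (bad-conjugate (to i) bad-g)

      -- The first component is the conjugate of `g` by `to i`, again bad; the second locates `to i`
      -- within its coset of the centraliser, leaving `badCount + badCount` possibilities.
      code : Fin order → Fin (badCount * (badCount + badCount))
      code i = combine (classIndex i)
        (join badCount badCount (centralizerIndex (offset i) (offset-commutes i)))

      code-injective : Injective _≡_ _≡_ code
      code-injective {i} {j} eq =
        let eq₁ , eq₂ = Fin.combine-injective (classIndex i) _ (classIndex j) _ eq
            same-class : conjugacyClass i ≡ conjugacyClass j
            same-class = from-cong (badIndex-injective
              (bad-conjugate (to i) bad-g) (bad-conjugate (to j) bad-g) eq₁)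
        -- Equal classes share the same `base`, which therefore cancels from the equal offsets.
        in to-injective (∙-cancelˡ _ (to i) (to j) (begin
          offset i                           ≈⟨ centralizerIndex-injective (offset-commutes i)
                                                  (offset-commutes j) (join-injective eq₂) ⟩
          offset j                           ≡⟨ cong (λ v → base v \\ to j) same-class ⟨
          base (conjugacyClass i) \\ to j    ∎))

      order≤badCount*2badCount : order ≤ badCount * (badCount + badCount)
      order≤badCount*2badCount = Fin.injective⇒≤ code-injective

-- Arithmetic of fractions and the passage to real cuts.

fromℚᵘ-homo-+ : ∀ p q → fromℚᵘ p ℚ.+ fromℚᵘ q ≡ fromℚᵘ (p ℚᵘ.+ q)
fromℚᵘ-homo-+ p q = ℚ.toℚᵘ-injective (begin-equality
  toℚᵘ (fromℚᵘ p ℚ.+ fromℚᵘ q)            ≃⟨ ℚ.toℚᵘ-homo-+ (fromℚᵘ p) (fromℚᵘ q) ⟩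
  toℚᵘ (fromℚᵘ p) ℚᵘ.+ toℚᵘ (fromℚᵘ q)    ≃⟨ ℚᵘ.+-cong (ℚ.toℚᵘ-fromℚᵘ p) (ℚ.toℚᵘ-fromℚᵘ q) ⟩
  p ℚᵘ.+ q                                ≃⟨ ℚ.toℚᵘ-fromℚᵘ (p ℚᵘ.+ q) ⟨
  toℚᵘ (fromℚᵘ (p ℚᵘ.+ q))                ∎)
  where open ℚᵘ.≤-Reasoning

fromℚᵘ-homo-* : ∀ p q → fromℚᵘ p ℚ.* fromℚᵘ q ≡ fromℚᵘ (p ℚᵘ.* q)
fromℚᵘ-homo-* p q = ℚ.toℚᵘ-injective (begin-equality
  toℚᵘ (fromℚᵘ p ℚ.* fromℚᵘ q)            ≃⟨ ℚ.toℚᵘ-homo-* (fromℚᵘ p) (fromℚᵘ q) ⟩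
  toℚᵘ (fromℚᵘ p) ℚᵘ.* toℚᵘ (fromℚᵘ q)    ≃⟨ ℚᵘ.*-cong (ℚ.toℚᵘ-fromℚᵘ p) (ℚ.toℚᵘ-fromℚᵘ q) ⟩
  p ℚᵘ.* q                                ≃⟨ ℚ.toℚᵘ-fromℚᵘ (p ℚᵘ.* q) ⟨
  toℚᵘ (fromℚᵘ (p ℚᵘ.* q))                ∎)
  where open ℚᵘ.≤-Reasoning

fromℚᵘ-mono-≤ : ∀ {p q} → p ℚᵘ.≤ q → fromℚᵘ p ℚ.≤ fromℚᵘ q
fromℚᵘ-mono-≤ {p} {q} p≤q = ℚ.toℚᵘ-cancel-≤ (begin
  toℚᵘ (fromℚᵘ p)    ≃⟨ ℚ.toℚᵘ-fromℚᵘ p ⟩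
  p                  ≤⟨ p≤q ⟩
  q                  ≃⟨ ℚ.toℚᵘ-fromℚᵘ q ⟨
  toℚᵘ (fromℚᵘ q)    ∎)
  where open ℚᵘ.≤-Reasoning

-- For a successor `n`, `+ t / n` unfolds to `fromℚᵘ` of an unnormalised fraction. The sum of the
-- two fractions being 1 thus becomes a cross-multiplied identity in ℤ, free of gcds.
complementary-fractions : ∀ m t {n} .{{_ : NonZero n}} → m + t ≡ n → + t / n ≡ 1ℚ ℚ.- + m / n
complementary-fractions m t {n@(suc d)} m+t≡n =
  x≈z//y (+ t / n) (+ m / n) 1ℚ (≡.trans (fromℚᵘ-homo-+ (mkℚᵘ (+ t) d) (mkℚᵘ (+ m) d))
    (ℚ.fromℚᵘ-cong {mkℚᵘ (+ t) d ℚᵘ.+ mkℚᵘ (+ m) d} {ℚᵘ.1ℚᵘ} (*≡* (begin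
      (+ t ℤ.* + n ℤ.+ + m ℤ.* + n) ℤ.* ℤ.1ℤ  ≡⟨ ℤ.*-identityʳ _ ⟩
      + t ℤ.* + n ℤ.+ + m ℤ.* + n             ≡⟨ ℤ.*-distribʳ-+ (+ n) (+ t) (+ m) ⟨
      (+ (t + m)) ℤ.* + n                     ≡⟨ cong (λ k → + k ℤ.* + n) (≡.trans (ℕ.+-comm t m) m+t≡n) ⟩
      + n ℤ.* + n                             ≡⟨ ℤ.*-identityˡ _ ⟨
      ℤ.1ℤ ℤ.* (+ n ℤ.* + n)                  ∎))))
  where
  open GroupProperties ℚ.+-0-group
  open ≡.≡-Reasoning

reciprocal-fractions : ∀ n t .{{_ : NonZero n}} .{{_ : NonZero t}} → (+ n / t) ℚ.* (+ t / n) ≡ 1ℚ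
reciprocal-fractions n@(suc d) t@(suc e) = ≡.trans (fromℚᵘ-homo-* (mkℚᵘ (+ n) e) (mkℚᵘ (+ t) d))
  (ℚ.fromℚᵘ-cong {mkℚᵘ (+ n) e ℚᵘ.* mkℚᵘ (+ t) d} {ℚᵘ.1ℚᵘ} (*≡* (begin
    (+ n ℤ.* + t) ℤ.* ℤ.1ℤ    ≡⟨ ℤ.*-identityʳ _ ⟩
    + n ℤ.* + t               ≡⟨ ℤ.*-comm (+ n) (+ t) ⟩
    + t ℤ.* + n               ≡⟨ ℤ.*-identityˡ _ ⟨
    ℤ.1ℤ ℤ.* (+ t ℤ.* + n)    ∎)))
  where open ≡.≡-Reasoning

square-fraction-≤ : ∀ n t k .{{_ : NonZero t}} → n * n ≤ k * (t * t) →
                    (+ n / t) ℚ.* (+ n / t) ℚ.≤ + k / 1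
square-fraction-≤ n t@(suc e) k n²≤kt² = subst (ℚ._≤ + k / 1)
  (≡.sym (fromℚᵘ-homo-* (mkℚᵘ (+ n) e) (mkℚᵘ (+ n) e)))
  (fromℚᵘ-mono-≤ {mkℚᵘ (+ n) e ℚᵘ.* mkℚᵘ (+ n) e} {mkℚᵘ (+ k) 0} (*≤* (begin
    (+ n ℤ.* + n) ℤ.* ℤ.1ℤ    ≡⟨ ℤ.*-identityʳ _ ⟩
    + n ℤ.* + n               ≡⟨ ℤ.pos-* n n ⟨
    + (n * n)                 ≤⟨ ℤ.+≤+ n²≤kt² ⟩
    + (k * (t * t))           ≡⟨ ℤ.pos-* k (t * t) ⟩
    + k ℤ.* + (t * t)         ≡⟨ cong (+ k ℤ.*_) (ℤ.pos-* t t) ⟩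
    + k ℤ.* (+ t ℤ.* + t)     ∎)))
  where open ℤ.≤-Reasoning

-- Here `s` is at most the root of `k`, so its reciprocal `a` is at least `1/√ k`. The cut asks for
-- a rational strictly below the root whose product with `p` exceeds 1; `1/ b` with `b` strictly
-- between `a` and `p` meets both demands.
upper-1/√ : ∀ {k} .{{_ : NonZero k}} s a {p} .{{_ : Positive s}} .{{_ : Positive a}} →
            s ℚ.* a ≡ 1ℚ → s ℚ.* s ℚ.≤ + k / 1 → a ℚ.< p → ℝ.upper (1/√ k) p
upper-1/√ s a {p} sa≡1 s²≤k a<p with b , a<b , b<p ← ℚ.<-dense a<p =
  let instance
        b-pos = ℚ.positive (ℚ.<-trans (ℚ.positive⁻¹ a) a<b)
        b-nonNeg = ℚ.pos⇒nonNeg b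
        b-nonZero = ℚ.pos⇒nonZero b
        1/b-pos = ℚ.1/pos⇒pos b
      open ℚ.≤-Reasoning
      1/b<s : 1/ b ℚ.< s
      1/b<s = ℚ.*-cancelʳ-<-nonNeg b (begin-strict
        1/ b ℚ.* b  ≡⟨ ℚ.*-inverseˡ b ⟩
        1ℚ          ≡⟨ sa≡1 ⟨
        s ℚ.* a     <⟨ ℚ.*-monoʳ-<-pos s a<b ⟩
        s ℚ.* b     ∎)
  in 1/ b , ℚ.positive⁻¹ (1/ b) , (s , 1/b<s , s²≤k) ,
     subst (ℚ._< p ℚ.* 1/ b) (ℚ.*-inverseʳ b) (ℚ.*-monoˡ-<-pos (1/ b) b<p)

fraction≤1-1/√ : ∀ m t {n} .{{_ : NonZero n}} .{{_ : NonZero (2 * n)}} →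
                 m + t ≡ n → n ≤ t * (t + t) →
                 fromℚ (+ m / n) ≤ᵣ 1ℚ -ᵣ 1/√ (2 * n)
fraction≤1-1/√ m t {n} m+t≡n n≤2t² {q} q<m/n =
  -- The lower cut of a difference at `q` is the upper cut of `1/√ (2 * n)` at `1ℚ ℚ.- q`, and `q`
  -- below `m / n` puts `t / n` below that point.
  upper-1/√ (+ n / t) (+ t / n) (reciprocal-fractions n t) (square-fraction-≤ n t (2 * n) n²≤2nt²)
    (subst (ℚ._< 1ℚ ℚ.- q) (≡.sym (complementary-fractions m t m+t≡n))
           (ℚ.+-monoʳ-< 1ℚ (ℚ.neg-antimono-< q<m/n)))
  where
  instance
    t-nonZero : NonZero t
    -- Since `n` is positive, so is `t * (t + t)`, hence its factor `t`.
    t-nonZero = ℕ.m*n≢0⇒m≢0 t {{ℕ.>-nonZero (ℕ.≤-trans (ℕ.>-nonZero⁻¹ n) n≤2t²)}}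
    _ = ℚ.normalize-pos n t
    _ = ℚ.normalize-pos t n
  n²≤2nt² : n * n ≤ 2 * n * (t * t)
  n²≤2nt² = begin
    n * n              ≤⟨ ℕ.*-monoʳ-≤ n n≤2t² ⟩
    n * (t * (t + t))  ≡⟨ solve 2 (λ n t → n :* (t :* (t :+ t)) := con 2 :* n :* (t :* t)) ≡.refl n t ⟩
    2 * n * (t * t)    ∎
    where
    open ℕ.≤-Reasoning
    open +-*-Solver

theorem2p9 : ∀ {c r} (G : FiniteGroup c r) (ℓ : ℤ) →
    let open FiniteGroup G renaming (order to n) in
    ¬ (+ exponent ∣ ℓ) →
    fromℚ (+ ∣ (λ g → g ^ ℓ ≟ ε) ∣ / n) ≤ᵣ 1ℚ -ᵣ 1/√ (2 * n)
theorem2p9 G ℓ e∤ℓ = fraction≤1-1/√ ∣ good? G ℓ ∣ (badCount G ℓ)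
  (count-complement (good? G ℓ) elements)
  (order≤badCount*2badCount G ℓ (proj₂ (bad-exists G ℓ e∤ℓ)))
  where open FiniteGroup G
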